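{- Let $\Gamma$ be a metrized graph with vertex set $V(\Gamma)$ and edge set $E(\Gamma)$, and let $r$ be its resistance function. Let $e_i \in E(\Gamma)$ be an edge of length $L_i$ with end points $p_i$ and $q_i$. If $x$ belongs to the edge $e_i$, then for any vertex $p \in V(\Gamma)$ we have $$r(p,x)= -x^2\, \frac{L_i - r(p_i,q_i)}{L_i^2}+x\, \frac{L_i-r(p_i,q_i)+r(p,q_i)-r(p,p_i)}{L_i}+r(p,p_i),$$ where on the right-hand side $x\in[0,L_i]$ denotes the parameter of the point $x\in e_i$.
   Context: A metrized graph $\Gamma$ is a finite connected graph whose edges are equipped with a distinguished parametrization by line segments (multiple edges and self-loops are allowed). The valence of $p\in\Gamma$ is the number of directions emanating from $p$. A vertex set $V(\Gamma)$ is a finite non-empty subset of $\Gamma$ containing every point of valence $\neq 2$ (additional points of valence 2 may be included). The set $E(\Gamma)$ of edges is the set of closed line segments with end points in $V(\Gamma)$ into which $V(\Gamma)$ divides $\Gamma$; the length of $e_i$ is a positive real number $L_i$. Parametrization convention: an edge $e_i$ of length $L_i$ with end points $p_i,q_i$ is identified with $[0,L_i]$ so that $p_i$ corresponds to $0$ and $q_i$ to $L_i$. A point of $e_i$ and the corresponding real number in $[0,L_i]$ are denoted by the same letter: in the arguments of $r$ the letters denote points of $\Gamma$, elsewhere in formulas they denote the real parameters. Voltage and resistance functions: view $\Gamma$ as a resistive electric circuit in which each edge has resistance equal to its length. For $x,y,z\in\Gamma$, $j_z(x,y)$ is the voltage difference between $x$ and $z$ when unit current enters at $y$ and exits at $z$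 (with reference voltage $0$ at $z$). Equivalently, for fixed $y,z$, $x\mapsto j_z(x,y)$ is the unique continuous piecewise affine function $f$ on $\Gamma$ with $f(z)=0$ and $\Delta f=\delta_y-\delta_z$, where $\Delta f=-\sum_{p}\sigma_p(f)\,\delta_p$ and $\sigma_p(f)$ is the sum of the slopes of $f$ in all directions emanating from $p$. The resistance function is $r(x,y)=j_y(x,x)$, the effective resistance between $x$ and $y$. -}

module Defs where

open import Algebra.Bundles using (CommutativeRing)
open import Algebra.Core using (Op₁; Op₂)
open import Algebra.Structures using (IsCommutativeRing)
import Algebra.Properties.CommutativeMonoid.Sum as Sum
open import Data.Bool.Base using (if_then_else_)
open import Data.Fin.Base using (Fin)
import Data.Fin.Properties as Fin
open import Data.Nat.Base using (ℕ; NonZero)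
open import Data.Product.Base using (∃; _×_)
open import Level using (Level; suc; _⊔_)
open import Relation.Binary.Construct.Closure.Equivalence using (EqClosure)
import Relation.Binary.Construct.StrictToNonStrict as StrictToNonStrict
open import Relation.Binary.Core using (Rel)
open import Relation.Binary.Definitions using (tri<; tri≈; tri>)
open import Relation.Binary.PropositionalEquality.Core using (_≡_; refl)
open import Relation.Binary.Structures using (IsStrictTotalOrder)
open import Relation.Nullary.Decidable.Core using (Dec; yes; no; does)
open import Relation.Nullary.Negation.Core using (¬_)
open import Relation.Unary using (Pred)

-- The field of real numbers, given by the classical axioms characterising it up
-- to isomorphism: a Dedekind-complete, totally ordered field.  The inverse is a
-- total operation that is unconstrained at 0#.
record RealField (c ℓ₁ ℓ₂ : Level) : Set (suc (c ⊔ ℓ₁ ⊔ ℓ₂)) where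
  infix  4 _≈_ _<_
  infixl 6 _+_ _-_
  infixl 7 _*_ _/_
  infix  8 -_
  infix  9 _⁻¹
  field
    Carrier            : Set c
    _≈_                : Rel Carrier ℓ₁
    _<_                : Rel Carrier ℓ₂
    _+_ _*_            : Op₂ Carrier
    -_ _⁻¹             : Op₁ Carrier
    0# 1#              : Carrier
    isCommutativeRing  : IsCommutativeRing _≈_ _+_ _*_ -_ 0# 1#
    isStrictTotalOrder : IsStrictTotalOrder _≈_ _<_
    0≉1                : ¬ (0# ≈ 1#)
    ⁻¹-inverseʳ        : ∀ x → ¬ (x ≈ 0#) → x * x ⁻¹ ≈ 1#
    +-monoʳ-<          : ∀ x {y z} → y < z → x + y < x + z
    *-pos              : ∀ {x y} → 0# < x → 0# < y → 0# < x * y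

  open StrictToNonStrict _≈_ _<_ public using (_≤_)

  IsUpperBound : ∀ {p} → Pred Carrier p → Pred Carrier (c ⊔ ℓ₁ ⊔ ℓ₂ ⊔ p)
  IsUpperBound P u = ∀ x → P x → x ≤ u

  field
    supremum : (P : Pred Carrier (c ⊔ ℓ₁ ⊔ ℓ₂)) → ∃ P → ∃ (IsUpperBound P) →
               ∃ λ s → IsUpperBound P s × (∀ u → IsUpperBound P u → s ≤ u)

  commutativeRing : CommutativeRing c ℓ₁
  commutativeRing = record { isCommutativeRing = isCommutativeRing }

  open CommutativeRing commutativeRing public using (+-commutativeMonoid)
  open IsStrictTotalOrder isStrictTotalOrder public using (compare; _≟_; _<?_)
  open Sum +-commutativeMonoid public using (sum)

  _-_ : Op₂ Carrier
  x - y = x + - y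

  _/_ : Op₂ Carrier
  x / y = x * y ⁻¹

module _ {c ℓ₁ ℓ₂} (ℝ : RealField c ℓ₁ ℓ₂) where
  open RealField ℝ

  -- A metrized graph together with a vertex set V(Γ) and the resulting edges
  -- E(Γ); loops and multiple edges are allowed.  The edge e is identified with
  -- [0, length e], source e being at 0 and target e at length e.
  record MetrizedGraph : Set (c ⊔ ℓ₂) where
    field
      #V #E         : ℕ
      source target : Fin #E → Fin #V
      length        : Fin #E → Carrier
      length-pos    : ∀ e → 0# < length e
      nonEmpty      : NonZero #V

    Vertex : Set
    Vertex = Fin #V

    Edge : Set
    Edge = Fin #E

    Adjacent : Rel Vertex _
    Adjacent u v = ∃ λ e → source e ≡ u × target e ≡ v

    field
      connected : ∀ u v → EqClosure Adjacent u v

module _ {c ℓ₁ ℓ₂} {ℝ : RealField c ℓ₁ ℓ₂} where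
  open RealField ℝ

  ----------------------------------------------------------------------
  -- Piecewise affine functions of one real variable

  AffineOn : (Carrier → Carrier) → (a b slope : Carrier) → Set (c ⊔ ℓ₁ ⊔ ℓ₂)
  AffineOn g a b s = ∀ t → a ≤ t → t ≤ b → g t ≈ g a + s * (t - a)

  -- A subdivision of [a, b] into closed intervals on each of which g is affine.
  -- As consecutive intervals share their end point, g is continuous on [a, b].
  data PiecewiseAffine (g : Carrier → Carrier) :
         (a b : Carrier) → Set (c ⊔ ℓ₁ ⊔ ℓ₂) where
    piece : ∀ {a b} → a < b → (s : Carrier) → AffineOn g a b s →
            PiecewiseAffine g a b
    cons  : ∀ {a b d} → a < b → (s : Carrier) → AffineOn g a b s →
            PiecewiseAffine g b d → PiecewiseAffine g a d

  -- The derivative from the right at t ∈ [a, b).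
  derivʳ : ∀ {g a b} → PiecewiseAffine g a b → Carrier → Carrier
  derivʳ (piece _ s _)              t = s
  derivʳ (cons {b = b} _ s _ rest) t =
    if does (t <? b) then s else derivʳ rest t

  -- The derivative from the left at t ∈ (a, b].
  derivˡ : ∀ {g a b} → PiecewiseAffine g a b → Carrier → Carrier
  derivˡ (piece _ s _)              t = s
  derivˡ (cons {b = b} _ s _ rest) t =
    if does (b <? t) then derivˡ rest t else s

  module _ (Γ : MetrizedGraph ℝ) where
    open MetrizedGraph Γ

    --------------------------------------------------------------------
    -- Points of Γ: the vertices and the points interior to an edge

    data Point : Set (c ⊔ ℓ₂) where
      vertex   : Vertex → Point
      interior : (e : Edge) (t : Carrier) → 0# < t → t < length e → Point

    infix 4 _≈ₚ_ _≟ₚ_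

    data _≈ₚ_ : Rel Point (c ⊔ ℓ₁ ⊔ ℓ₂) where
      vertex   : ∀ {v} → vertex v ≈ₚ vertex v
      interior : ∀ {e t t′ 0<t t<L 0<t′ t′<L} → t ≈ t′ →
                 interior e t 0<t t<L ≈ₚ interior e t′ 0<t′ t′<L

    _≟ₚ_ : (x y : Point) → Dec (x ≈ₚ y)
    vertex u ≟ₚ vertex v with u Fin.≟ v
    ... | yes refl = yes vertex
    ... | no  u≢v  = no λ { vertex → u≢v refl }
    vertex _ ≟ₚ interior _ _ _ _ = no λ ()
    interior _ _ _ _ ≟ₚ vertex _ = no λ ()
    interior e t _ _ ≟ₚ interior e′ t′ _ _ with e Fin.≟ e′ | t ≟ t′
    ... | yes refl | yes t≈t′ = yes (interior t≈t′)
    ... | yes refl | no  t≉t′ = no λ { (interior t≈t′) → t≉t′ t≈t′ }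
    ... | no  e≢e′ | _        = no λ { (interior _) → e≢e′ refl }

    -- The point of the edge e with parameter t ∈ [0, length e].  Parameters
    -- outside this interval, which are never used, are moved to the nearer end.
    point : Edge → Carrier → Point
    point e t with compare 0# t | compare t (length e)
    ... | tri< 0<t _ _ | tri< t<L _ _ = interior e t 0<t t<L
    ... | tri< _ _ _   | tri≈ _ _ _   = vertex (target e)
    ... | tri< _ _ _   | tri> _ _ _   = vertex (target e)
    ... | tri≈ _ _ _   | _            = vertex (source e)
    ... | tri> _ _ _   | _            = vertex (source e)

    --------------------------------------------------------------------
    -- Continuous piecewise affine functions on Γ and their Laplacian

    -- Continuity at the vertices holds because the restrictions to the closed
    -- edges, end points included, are continuous.
    record IsCPA (f : Point → Carrier) : Set (c ⊔ ℓ₁ ⊔ ℓ₂) where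
      field
        cong            : ∀ {x y} → x ≈ₚ y → f x ≈ f y
        piecewiseAffine : ∀ e → PiecewiseAffine (λ t → f (point e t)) 0# (length e)

      -- The sum σ_p(f) of the slopes of f in all directions emanating from p.
      -- A loop contributes two directions at its vertex.
      slopeSum : Point → Carrier
      slopeSum (vertex v) = sum λ e →
        (if does (source e Fin.≟ v) then derivʳ (piecewiseAffine e) 0# else 0#) +
        (if does (target e Fin.≟ v) then - derivˡ (piecewiseAffine e) (length e) else 0#)
      slopeSum (interior e t _ _) =
        derivʳ (piecewiseAffine e) t - derivˡ (piecewiseAffine e) t

      -- A finitely supported discrete measure ∑ₚ mₚ δₚ on Γ is represented by
      -- its mass function p ↦ mₚ.
      Δ : Point → Carrier
      Δ p = - slopeSum p

    δ : Point → Point → Carrier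
    δ y p = if does (y ≟ₚ p) then 1# else 0#

    --------------------------------------------------------------------
    -- Voltage and resistance

    -- f is the function x ↦ j_z(x, y).
    record IsVoltage (z y : Point) (f : Point → Carrier) : Set (c ⊔ ℓ₁ ⊔ ℓ₂) where
      field
        isCPA     : IsCPA f
        grounded  : f z ≈ 0#
        laplacian : ∀ p → IsCPA.Δ isCPA p ≈ δ y p - δ z p

    -- The function (z, x, y) ↦ j_z(x, y), given by its defining property, which
    -- determines it up to _≈_.
    record VoltageFunction : Set (c ⊔ ℓ₁ ⊔ ℓ₂) where
      field
        j         : (z x y : Point) → Carrier
        isVoltage : ∀ z y → IsVoltage z y (λ x → j z x y)

      resistance : Point → Point → Carrier
      resistance x y = j y x x

{-# OPTIONS --safe #-}
module Submission where

-- Let u_z = j_z(·, p), so that r(p, z) = u_z(p).  For x interior to the edge e_i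
-- from a to b, of length L, put μ = x / L and λ = 1 - μ.  The Laplacian of
-- u_x - λ u_a - μ u_b is -δ_x + λ δ_a + μ δ_b, which is also that of the function
-- vanishing off e_i, affine on [a, x] and [x, b], with value -λμL at x.  The
-- difference of the two is constant, and evaluating it at p, a and b gives
--   r(p, x) = λ r(p, a) + μ r(p, b) + λμL - λμ (u_a(b) + u_b(a)).
-- Likewise u_b - u_a - j_b(·, a) is constant, whence u_a(b) + u_b(a) = r(a, b).
-- Only values at vertices matter, and on vertex potentials of the weighted graph
-- the uniqueness "harmonic implies constant" follows from the Dirichlet energy
-- ∑ slope² · length being zero.

open import Defs

open import Algebra.Bundles using (CommutativeRing)
import Algebra.Properties.Ring as RingProperties
import Algebra.Properties.Semiring.Mult.TCOptimised as Mult
import Algebra.Properties.Semiring.Sum as SemiringSum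
import Algebra.Solver.Ring as RingSolver
open import Algebra.Solver.Ring.AlmostCommutativeRing
  using (_-Raw-AlmostCommutative⟶_; fromCommutativeRing)
open import Data.Bool.Base using (true; false; if_then_else_)
open import Data.Fin.Base using (Fin; zero; suc)
import Data.Fin.Properties as Fin
open import Data.Integer.Base as ℤ using (ℤ; +_; -[1+_]; _⊖_; 0ℤ; 1ℤ)
import Data.Integer.Properties as ℤ
open import Data.Maybe.Base using (just; nothing)
open import Data.Nat.Base as ℕ using (ℕ)
open import Data.Product.Base using (_×_; _,_; proj₁; proj₂)
open import Data.Sum.Base using (inj₁; inj₂)
open import Function.Base using (_∘_)
open import Level using (_⊔_)
import Relation.Binary.Construct.Closure.Equivalence as EqClosure
import Relation.Binary.Construct.StrictToNonStrict as StrictToNonStrict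
open import Relation.Binary.Definitions using (WeaklyDecidable; tri<; tri≈; tri>)
open import Relation.Binary.PropositionalEquality.Core as ≡ using (_≡_)
import Relation.Binary.Reasoning.Setoid as ≈-Reasoning
open import Relation.Binary.Structures using (IsStrictTotalOrder)
open import Relation.Nullary.Decidable using (yes; no; does; dec-true; dec-false)
open import Relation.Nullary.Negation using (¬_; contradiction)

-- The integers as coefficients for ring identities.

-- The library's ring solver decides cancellation only with computing
-- coefficients, hence the integers.
module IntegerCoefficients {c ℓ} (R : CommutativeRing c ℓ) where
  open CommutativeRing R
  open RingProperties ring
  open Mult semiring renaming (_×_ to _·_)
  open ≈-Reasoning setoid

  ⟦_⟧ : ℤ → Carrier
  ⟦ + n      ⟧ = n · 1#
  ⟦ -[1+ n ] ⟧ = - (ℕ.suc n · 1#)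

  ⊖-homo : ∀ m n → ⟦ m ⊖ n ⟧ ≈ m · 1# - n · 1#
  ⊖-homo m ℕ.zero = begin
    m · 1#        ≈⟨ +-identityʳ _ ⟨
    m · 1# + 0#   ≈⟨ +-congˡ -0#≈0# ⟨
    m · 1# - 0#   ∎
  ⊖-homo ℕ.zero (ℕ.suc n) = sym (+-identityˡ _)
  ⊖-homo (ℕ.suc m) (ℕ.suc n) = begin
    ⟦ ℕ.suc m ⊖ ℕ.suc n ⟧            ≡⟨ ≡.cong ⟦_⟧ (ℤ.[1+m]⊖[1+n]≡m⊖n m n) ⟩
    ⟦ m ⊖ n ⟧                        ≈⟨ ⊖-homo m n ⟩
    m · 1# - n · 1#                  ≈⟨ +-congʳ (+-identityʳ _) ⟨
    -- The inserted `1# - 1#` supplies the unit that turns each of `m` and `n` into its successor.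
    m · 1# + 0# - n · 1#             ≈⟨ +-congʳ (+-congˡ (-‿inverseʳ 1#)) ⟨
    m · 1# + (1# - 1#) - n · 1#      ≈⟨ +-congʳ (+-assoc _ _ _) ⟨
    m · 1# + 1# - 1# - n · 1#        ≈⟨ +-assoc _ _ _ ⟩
    m · 1# + 1# + (- 1# - n · 1#)    ≈⟨ +-cong (+-comm _ _) (-‿+-comm 1# (n · 1#)) ⟩
    1# + m · 1# - (1# + n · 1#)      ≈⟨ +-cong (1+× m 1#) (-‿cong (1+× n 1#)) ⟨
    ℕ.suc m · 1# - ℕ.suc n · 1#      ∎

  +-homo : ∀ i j → ⟦ i ℤ.+ j ⟧ ≈ ⟦ i ⟧ + ⟦ j ⟧
  +-homo (+ m)    (+ n)    = ×-homo-+ 1# m n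
  +-homo (+ m)    -[1+ n ] = ⊖-homo m (ℕ.suc n)
  +-homo -[1+ m ] (+ n)    = trans (⊖-homo n (ℕ.suc m)) (+-comm _ _)
  +-homo -[1+ m ] -[1+ n ] = begin
    ⟦ -[1+ m ] ℤ.+ -[1+ n ] ⟧                ≡⟨ ≡.cong ⟦_⟧ (ℤ.neg-distrib-+ (+ ℕ.suc m) (+ ℕ.suc n)) ⟨
    - ((ℕ.suc m ℕ.+ ℕ.suc n) · 1#)           ≈⟨ -‿cong (×-homo-+ 1# (ℕ.suc m) (ℕ.suc n)) ⟩
    - (ℕ.suc m · 1# + ℕ.suc n · 1#)          ≈⟨ -‿+-comm _ _ ⟨
    - (ℕ.suc m · 1#) - ℕ.suc n · 1#          ∎

  -‿homo : ∀ i → ⟦ ℤ.- i ⟧ ≈ - ⟦ i ⟧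
  -‿homo (+ ℕ.zero)  = sym -0#≈0#
  -‿homo (+ ℕ.suc n) = refl
  -‿homo -[1+ n ]    = sym (-‿involutive _)

  *-homo-pos : ∀ m j → ⟦ + m ℤ.* j ⟧ ≈ m · 1# * ⟦ j ⟧
  *-homo-pos m (+ n) = begin
    ⟦ + m ℤ.* + n ⟧     ≡⟨ ≡.cong ⟦_⟧ (ℤ.pos-* m n) ⟨
    (m ℕ.* n) · 1#      ≈⟨ ×1-homo-* m n ⟩
    m · 1# * n · 1#     ∎
  *-homo-pos m -[1+ n ] = begin
    ⟦ + m ℤ.* -[1+ n ] ⟧           ≡⟨ ≡.cong ⟦_⟧ (ℤ.neg-distribʳ-* (+ m) (+ ℕ.suc n)) ⟨
    ⟦ ℤ.- (+ m ℤ.* + ℕ.suc n) ⟧    ≈⟨ -‿homo (+ m ℤ.* + ℕ.suc n) ⟩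
    - ⟦ + m ℤ.* + ℕ.suc n ⟧        ≈⟨ -‿cong (*-homo-pos m (+ ℕ.suc n)) ⟩
    - (m · 1# * ℕ.suc n · 1#)      ≈⟨ -‿distribʳ-* _ _ ⟩
    m · 1# * - (ℕ.suc n · 1#)      ∎

  *-homo : ∀ i j → ⟦ i ℤ.* j ⟧ ≈ ⟦ i ⟧ * ⟦ j ⟧
  *-homo (+ m)    j = *-homo-pos m j
  *-homo -[1+ m ] j = begin
    ⟦ -[1+ m ] ℤ.* j ⟧             ≡⟨ ≡.cong ⟦_⟧ (ℤ.neg-distribˡ-* (+ ℕ.suc m) j) ⟨
    ⟦ ℤ.- (+ ℕ.suc m ℤ.* j) ⟧      ≈⟨ -‿homo (+ ℕ.suc m ℤ.* j) ⟩
    - ⟦ + ℕ.suc m ℤ.* j ⟧          ≈⟨ -‿cong (*-homo-pos (ℕ.suc m) j) ⟩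
    - (ℕ.suc m · 1# * ⟦ j ⟧)       ≈⟨ -‿distribˡ-* _ _ ⟩
    - (ℕ.suc m · 1#) * ⟦ j ⟧       ∎

  homomorphism : ℤ.+-*-rawRing -Raw-AlmostCommutative⟶ fromCommutativeRing R
  homomorphism = record
    { ⟦_⟧ = ⟦_⟧; +-homo = +-homo; *-homo = *-homo; -‿homo = -‿homo
    ; 0-homo = refl; 1-homo = refl }

  _coeff≟_ : WeaklyDecidable (λ i j → ⟦ i ⟧ ≈ ⟦ j ⟧)
  i coeff≟ j with i ℤ.≟ j
  ... | yes ≡.refl = just refl
  ... | no  _      = nothing

  open RingSolver ℤ.+-*-rawRing (fromCommutativeRing R) homomorphism _coeff≟_ public
    using (solve; con; _:+_; _:*_; _:-_; :-_; _:=_)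

-- Ordered-field arithmetic and finite sums.

module RealFieldProperties {c ℓ₁ ℓ₂} (ℝ : RealField c ℓ₁ ℓ₂) where
  open RealField ℝ public
  open CommutativeRing commutativeRing public
    using ( refl; sym; trans; reflexive; setoid; ring; semiring; +-cong; +-congˡ; +-congʳ
          ; *-cong; *-congˡ; *-congʳ; -‿cong; +-identityˡ; +-identityʳ; *-identityʳ
          ; zeroˡ; zeroʳ; -‿inverseʳ)
  open RingProperties ring public using (x∙y⁻¹≈ε⇒x≈y; -0#≈0#)
  open IntegerCoefficients commutativeRing public
    using (solve; con; _:+_; _:*_; _:-_; :-_; _:=_)
  open SemiringSum semiring public
    using (sum-cong-≋; sum-replicate-zero; ∑-distrib-+; ∑-comm; *-distribˡ-sum)
  open IsStrictTotalOrder isStrictTotalOrder public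
    using (<-respˡ-≈; <-respʳ-≈; irrefl) renaming (trans to <-trans)
  private module ≤ = StrictToNonStrict _≈_ _<_
  open ≈-Reasoning setoid

  <-≤-trans : ∀ {x y z} → x < y → y ≤ z → x < z
  <-≤-trans = ≤.<-≤-trans <-trans <-respʳ-≈

  ≤-<-trans : ∀ {x y z} → x ≤ y → y < z → x < z
  ≤-<-trans = ≤.≤-<-trans sym <-trans <-respˡ-≈

  ≤-trans : ∀ {x y z} → x ≤ y → y ≤ z → x ≤ z
  ≤-trans (inj₁ x<y) y≤z        = inj₁ (<-≤-trans x<y y≤z)
  ≤-trans (inj₂ x≈y) (inj₁ y<z) = inj₁ (<-respˡ-≈ (sym x≈y) y<z)
  ≤-trans (inj₂ x≈y) (inj₂ y≈z) = inj₂ (trans x≈y y≈z)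

  ≮⇒≥ : ∀ {x y} → ¬ x < y → y ≤ x
  ≮⇒≥ {x} {y} x≮y with compare x y
  ... | tri< x<y _ _ = contradiction x<y x≮y
  ... | tri≈ _ x≈y _ = inj₂ (sym x≈y)
  ... | tri> _ _ y<x = inj₁ y<x

  -- With u ≈ v a linear combination of hypotheses, only a ring identity is left to prove.
  equation-combination : ∀ {a b u v} → u ≈ v → a - b ≈ u - v → a ≈ b
  equation-combination {a} {b} {u} {v} u≈v eq = x∙y⁻¹≈ε⇒x≈y a b (begin
    a - b   ≈⟨ eq ⟩
    u - v   ≈⟨ +-congʳ u≈v ⟩
    v - v   ≈⟨ -‿inverseʳ v ⟩
    0#      ∎)

  +-mono-<-≤ : ∀ {x y} → 0# < x → 0# ≤ y → 0# < x + y
  +-mono-<-≤ {x} {y} 0<x 0≤y = <-≤-trans 0<x (x≤x+y 0≤y)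
    where
    x≤x+y : 0# ≤ y → x ≤ x + y
    x≤x+y (inj₁ 0<y) = inj₁ (<-respˡ-≈ (+-identityʳ x) (+-monoʳ-< x 0<y))
    x≤x+y (inj₂ 0≈y) = inj₂ (trans (sym (+-identityʳ x)) (+-congˡ 0≈y))

  +-nonNeg : ∀ {x y} → 0# ≤ x → 0# ≤ y → 0# ≤ x + y
  +-nonNeg (inj₁ 0<x) 0≤y = inj₁ (+-mono-<-≤ 0<x 0≤y)
  +-nonNeg {y = y} (inj₂ 0≈x) 0≤y =
    ≤-trans 0≤y (inj₂ (trans (sym (+-identityˡ y)) (+-congʳ 0≈x)))

  nonNeg-+≈0ˡ : ∀ {x y} → 0# ≤ x → 0# ≤ y → x + y ≈ 0# → x ≈ 0#
  nonNeg-+≈0ˡ (inj₁ 0<x) 0≤y x+y≈0 = contradiction (+-mono-<-≤ 0<x 0≤y) (irrefl (sym x+y≈0))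
  nonNeg-+≈0ˡ (inj₂ 0≈x) _   _     = sym 0≈x

  sum-nonNeg : ∀ {n} (f : Fin n → Carrier) → (∀ i → 0# ≤ f i) → 0# ≤ sum f
  sum-nonNeg {ℕ.zero}  f 0≤f = inj₂ refl
  sum-nonNeg {ℕ.suc n} f 0≤f = +-nonNeg (0≤f zero) (sum-nonNeg (f ∘ suc) (0≤f ∘ suc))

  sum≈0⇒≈0 : ∀ {n} (f : Fin n → Carrier) → (∀ i → 0# ≤ f i) → sum f ≈ 0# → ∀ i → f i ≈ 0#
  sum≈0⇒≈0 {ℕ.suc n} f 0≤f Σ≈0 i = go i
    where
    f₀≈0 : f zero ≈ 0#
    f₀≈0 = nonNeg-+≈0ˡ (0≤f zero) (sum-nonNeg (f ∘ suc) (0≤f ∘ suc)) Σ≈0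
    go : ∀ i → f i ≈ 0#
    go zero    = f₀≈0
    go (suc i) = sum≈0⇒≈0 (f ∘ suc) (0≤f ∘ suc)
      (trans (trans (sym (+-identityˡ _)) (+-congʳ (sym f₀≈0))) Σ≈0) i

  x≉0⇒0<x² : ∀ x → ¬ x ≈ 0# → 0# < x * x
  x≉0⇒0<x² x x≉0 with compare 0# x
  ... | tri< 0<x _ _ = *-pos 0<x 0<x
  ... | tri≈ _ 0≈x _ = contradiction (sym 0≈x) x≉0
  ... | tri> _ _ x<0 = <-respʳ-≈ (solve 1 (λ x → (:- x) :* (:- x) := x :* x) refl x) (*-pos 0<-x 0<-x)
    where
    0<-x : 0# < - x
    0<-x = <-respˡ-≈ (solve 1 (λ x → (:- x) :+ x := con 0ℤ) refl x)
             (<-respʳ-≈ (+-identityʳ (- x)) (+-monoʳ-< (- x) x<0))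

  0≤x²*y : ∀ x {y} → 0# < y → 0# ≤ x * x * y
  0≤x²*y x {y} 0<y with x ≟ 0#
  ... | no  x≉0 = inj₁ (*-pos (x≉0⇒0<x² x x≉0) 0<y)
  ... | yes x≈0 = inj₂ (sym (trans (*-congʳ (trans (*-congʳ x≈0) (zeroˡ x))) (zeroˡ y)))

  x²*y≈0⇒x≈0 : ∀ x {y} → 0# < y → x * x * y ≈ 0# → x ≈ 0#
  x²*y≈0⇒x≈0 x 0<y eq with x ≟ 0#
  ... | yes x≈0 = x≈0
  ... | no  x≉0 = contradiction (*-pos (x≉0⇒0<x² x x≉0) 0<y) (irrefl (sym eq))

  0<x⇒x≉0 : ∀ {x} → 0# < x → ¬ x ≈ 0#
  0<x⇒x≉0 0<x x≈0 = irrefl (sym x≈0) 0<x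

  -- `_⁻¹` is constrained only by the inverse law, so `N` is multiplied by two copies of
  -- `x * M ≈ 1#` and `x * x` is then cancelled against `N`.
  square-⁻¹ : ∀ {x} → 0# < x → (x * x) ⁻¹ ≈ x ⁻¹ * x ⁻¹
  square-⁻¹ {x} 0<x = begin
    N                        ≈⟨ solve 1 (λ N → N := N :* (con 1ℤ :* con 1ℤ)) refl N ⟩
    N * (1# * 1#)            ≈⟨ *-congˡ (*-cong x*M≈1 x*M≈1) ⟨
    N * (x * M * (x * M))    ≈⟨ solve 3 (λ x M N → N :* (x :* M :* (x :* M)) := x :* x :* N :* (M :* M)) refl x M N ⟩
    x * x * N * (M * M)      ≈⟨ *-congʳ (⁻¹-inverseʳ (x * x) (0<x⇒x≉0 (*-pos 0<x 0<x))) ⟩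
    1# * (M * M)             ≈⟨ solve 1 (λ M → con 1ℤ :* (M :* M) := M :* M) refl M ⟩
    M * M                    ∎
    where
    M = x ⁻¹
    N = (x * x) ⁻¹
    x*M≈1 = ⁻¹-inverseʳ x (0<x⇒x≉0 0<x)

  -- The Kronecker delta, compared in the same order as in `slopeSum` and `δ`, so that their
  -- conditionals match it.
  ind : ∀ {n} → Fin n → Fin n → Carrier
  ind i k = if does (i Fin.≟ k) then 1# else 0#

  sum-ind : ∀ {n} (i : Fin n) (h : Fin n → Carrier) → sum (λ k → h k * ind i k) ≈ h i
  sum-ind {ℕ.suc n} zero h = begin
    h zero * 1# + sum (λ k → h (suc k) * 0#)   ≈⟨ +-cong (*-identityʳ _) (sum-cong-≋ (λ k → zeroʳ (h (suc k)))) ⟩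
    h zero + sum {n} (λ _ → 0#)                ≈⟨ +-congˡ (sum-replicate-zero n) ⟩
    h zero + 0#                                ≈⟨ +-identityʳ _ ⟩
    h zero                                     ∎
  sum-ind {ℕ.suc n} (suc i) h = begin
    h zero * 0# + sum (λ k → h (suc k) * ind i k)   ≈⟨ +-cong (zeroʳ _) (sum-ind i (h ∘ suc)) ⟩
    0# + h (suc i)                                  ≈⟨ +-identityˡ _ ⟩
    h (suc i)                                       ∎

  *-ind : ∀ b x → (if b then x else 0#) ≈ x * (if b then 1# else 0#)
  *-ind true  x = sym (*-identityʳ x)
  *-ind false x = sym (zeroʳ x)

-- Piecewise affine functions of one real variable.

module PiecewiseAffineProperties {c ℓ₁ ℓ₂} (ℝ : RealField c ℓ₁ ℓ₂) where
  open RealFieldProperties ℝ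

  start<end : ∀ {g a b} → PiecewiseAffine {ℝ = ℝ} g a b → a < b
  start<end (piece a<b _ _)   = a<b
  start<end (cons a<b _ _ P) = <-trans a<b (start<end P)

  module _ {g a b d} (a<b : a < b) (s : Carrier) (A : AffineOn {ℝ = ℝ} g a b s)
           (P : PiecewiseAffine {ℝ = ℝ} g b d) where

    -- At the break point `b` the right derivative already belongs to the next piece, the left
    -- derivative still to the current one; hence the different forms of the hypotheses.
    derivʳ-head : ∀ {t} → t < b → derivʳ {ℝ = ℝ} (cons a<b s A P) t ≡ s
    derivʳ-head {t} t<b rewrite dec-true (t <? b) t<b = ≡.refl

    derivʳ-tail : ∀ {t} → ¬ t < b → derivʳ {ℝ = ℝ} (cons a<b s A P) t ≡ derivʳ {ℝ = ℝ} P t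
    derivʳ-tail {t} t≮b rewrite dec-false (t <? b) t≮b = ≡.refl

    derivˡ-head : ∀ {t} → ¬ b < t → derivˡ {ℝ = ℝ} (cons a<b s A P) t ≡ s
    derivˡ-head {t} b≮t rewrite dec-false (b <? t) b≮t = ≡.refl

    derivˡ-tail : ∀ {t} → b < t → derivˡ {ℝ = ℝ} (cons a<b s A P) t ≡ derivˡ {ℝ = ℝ} P t
    derivˡ-tail {t} b<t rewrite dec-true (b <? t) b<t = ≡.refl

  affine-increment : ∀ {g a b s t t′} → AffineOn {ℝ = ℝ} g a b s → a ≤ t → t ≤ t′ → t′ ≤ b →
                     g t′ ≈ g t + s * (t′ - t)
  affine-increment {g} {a} {b} {s} {t} {t′} A a≤t t≤t′ t′≤b =
    equation-combination
      (+-cong (A t′ (≤-trans a≤t t≤t′) t′≤b) (-‿cong (A t a≤t (≤-trans t≤t′ t′≤b))))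
      (solve 7 (λ a s t t′ y y′ x → y′ :- (y :+ s :* (t′ :- t))
                  := (y′ :- y) :- ((x :+ s :* (t′ :- a)) :- (x :+ s :* (t :- a))))
         refl a s t t′ (g t) (g t′) (g a))

  -- Induction on the subdivision: at a break point strictly between `t` and `t′` the one-sided
  -- derivatives agree, so neighbouring pieces have equal slopes and join. Kinks at `t` and `t′`
  -- themselves are allowed, which matters when one of them is a pole.
  smooth⇒affine : ∀ {g a b t t′} (P : PiecewiseAffine {ℝ = ℝ} g a b) → a ≤ t → t < t′ → t′ ≤ b →
    (∀ s → t < s → s < t′ → derivˡ {ℝ = ℝ} P s ≈ derivʳ {ℝ = ℝ} P s) →
    derivˡ {ℝ = ℝ} P t′ ≈ derivʳ {ℝ = ℝ} P t × g t′ ≈ g t + derivʳ {ℝ = ℝ} P t * (t′ - t)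
  smooth⇒affine (piece _ s A) a≤t t<t′ t′≤b _ = refl , affine-increment A a≤t (inj₁ t<t′) t′≤b
  smooth⇒affine {g} {t = t} {t′} (cons {b = m} a<m s A P) a≤t t<t′ t′≤d smooth
    with t <? m | m <? t′
  ... | yes t<m | no m≮t′ = refl , affine-increment A a≤t (inj₁ t<t′) (≮⇒≥ m≮t′)
  ... | no t≮m  | no m≮t′ = contradiction (<-≤-trans t<t′ (≮⇒≥ m≮t′)) t≮m
  ... | no t≮m  | yes m<t′ = smooth⇒affine P (≮⇒≥ t≮m) t<t′ t′≤d λ u t<u u<t′ →
    let m<u = ≤-<-trans (≮⇒≥ t≮m) t<u in
    trans (reflexive (≡.sym (derivˡ-tail a<m s A P m<u)))
      (trans (smooth u t<u u<t′) (reflexive (derivʳ-tail a<m s A P (λ u<m → irrefl refl (<-trans m<u u<m)))))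
  -- The break point `m` lies inside the window: the increments over `[t, m]` and `[m, t′]` are
  -- added after identifying their slopes.
  ... | yes t<m | yes m<t′ =
    trans (proj₁ tail) (sym s≈s′) ,
    equation-combination
      (+-cong (+-cong (proj₂ tail) (affine-increment A a≤t (inj₁ t<m) (inj₂ refl)))
              (*-congʳ (sym s≈s′)))
      (solve 8 (λ t m t′ s s′ x y z → z :- (x :+ s :* (t′ :- t))
                  := ((z :+ y) :+ s′ :* (t′ :- m))
                     :- (((y :+ s′ :* (t′ :- m)) :+ (x :+ s :* (m :- t))) :+ s :* (t′ :- m)))
         refl t m t′ s (derivʳ {ℝ = ℝ} P m) (g t) (g m) (g t′))
    where
    tail : derivˡ {ℝ = ℝ} P t′ ≈ derivʳ {ℝ = ℝ} P m × g t′ ≈ g m + derivʳ {ℝ = ℝ} P m * (t′ - m)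
    tail = smooth⇒affine P (inj₂ refl) m<t′ t′≤d λ u m<u u<t′ →
      trans (reflexive (≡.sym (derivˡ-tail a<m s A P m<u)))
        (trans (smooth u (<-trans t<m m<u) u<t′)
               (reflexive (derivʳ-tail a<m s A P (λ u<m → irrefl refl (<-trans m<u u<m)))))
    s≈s′ : s ≈ derivʳ {ℝ = ℝ} P m
    s≈s′ = trans (reflexive (≡.sym (derivˡ-head a<m s A P (irrefl refl))))
             (trans (smooth m t<m m<t′) (reflexive (derivʳ-tail a<m s A P (irrefl refl))))

-- Potentials on the vertices of the weighted graph.

module Potentials {c ℓ₁ ℓ₂} (ℝ : RealField c ℓ₁ ℓ₂) (Γ : MetrizedGraph ℝ) where
  open RealFieldProperties ℝ
  open MetrizedGraph Γ
  open ≈-Reasoning setoid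

  -- The signed incidence matrix: an edge of slope `s` emanates with slope `s` at its source and
  -- `- s` at its target, and for a loop the two cancel.
  incidence : Edge → Vertex → Carrier
  incidence e v = ind (source e) v - ind (target e) v

  -- The edgewise half of summation by parts.
  sum-incidence : ∀ e (h : Vertex → Carrier) →
                  sum (λ v → h v * incidence e v) ≈ h (source e) - h (target e)
  sum-incidence e h = begin
    sum (λ v → h v * incidence e v)
      ≈⟨ sum-cong-≋ (λ v → solve 3 (λ h s t → h :* (s :- t) := h :* s :+ (:- h) :* t) refl
                              (h v) (ind (source e) v) (ind (target e) v)) ⟩
    sum (λ v → h v * ind (source e) v + - h v * ind (target e) v)
      ≈⟨ ∑-distrib-+ (λ v → h v * ind (source e) v) (λ v → - h v * ind (target e) v) ⟩
    sum (λ v → h v * ind (source e) v) + sum (λ v → - h v * ind (target e) v)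
      ≈⟨ +-cong (sum-ind (source e) h) (sum-ind (target e) (λ v → - h v)) ⟩
    h (source e) - h (target e) ∎

  -- The restriction w to the vertices of a function on Γ which is affine on
  -- every edge and whose Laplacian has mass m v at the vertex v.
  record IsPotential (w m : Vertex → Carrier) : Set (c ⊔ ℓ₁) where
    field
      slope   : Edge → Carrier
      rise    : ∀ e → w (target e) ≈ w (source e) + slope e * length e
      balance : ∀ v → sum (λ e → slope e * incidence e v) ≈ - m v

  -- Linearity of the Laplacian; iterating it builds the differences whose masses cancel.
  potential-combination : ∀ {w m w′ m′} → IsPotential w m → IsPotential w′ m′ → ∀ k →
    IsPotential (λ v → w v + k * w′ v) (λ v → m v + k * m′ v)
  potential-combination {w} {m} {w′} {m′} W W′ k = record
    { slope   = λ e → W.slope e + k * W′.slope e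
    ; rise    = λ e → equation-combination (+-cong (W.rise e) (*-congˡ (W′.rise e)))
        (solve 8 (λ k x x′ y y′ s s′ l → (y :+ k :* y′) :- ((x :+ k :* x′) :+ (s :+ k :* s′) :* l)
                    := (y :+ k :* y′) :- ((x :+ s :* l) :+ k :* (x′ :+ s′ :* l)))
           refl k (w (source e)) (w′ (source e)) (w (target e)) (w′ (target e))
           (W.slope e) (W′.slope e) (length e))
    ; balance = λ v → begin
        sum (λ e → (W.slope e + k * W′.slope e) * incidence e v)
          ≈⟨ sum-cong-≋ (λ e → solve 4 (λ k s s′ i → (s :+ k :* s′) :* i := s :* i :+ k :* (s′ :* i)) refl
                                  k (W.slope e) (W′.slope e) (incidence e v)) ⟩
        sum (λ e → W.slope e * incidence e v + k * (W′.slope e * incidence e v))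
          ≈⟨ ∑-distrib-+ (λ e → W.slope e * incidence e v) (λ e → k * (W′.slope e * incidence e v)) ⟩
        sum (λ e → W.slope e * incidence e v) + sum (λ e → k * (W′.slope e * incidence e v))
          ≈⟨ +-congˡ (*-distribˡ-sum k (λ e → W′.slope e * incidence e v)) ⟨
        sum (λ e → W.slope e * incidence e v) + k * sum (λ e → W′.slope e * incidence e v)
          ≈⟨ +-cong (W.balance v) (*-congˡ (W′.balance v)) ⟩
        - m v + k * - m′ v
          ≈⟨ solve 3 (λ k m m′ → (:- m) :+ k :* (:- m′) := :- (m :+ k :* m′)) refl k (m v) (m′ v) ⟩
        - (m v + k * m′ v) ∎
    }
    where
    module W  = IsPotential W
    module W′ = IsPotential W′

  module _ {w m} (W : IsPotential w m) (m≈0 : ∀ v → m v ≈ 0#) where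
    open IsPotential W

    -- Summation by parts: one factor `slope e * length e` is the rise of `w` along `e`, and
    -- exchanging the sums leaves the total slope at each vertex, which is zero.
    energy≈0 : sum (λ e → slope e * slope e * length e) ≈ 0#
    energy≈0 = begin
      sum (λ e → slope e * slope e * length e)
        ≈⟨ sum-cong-≋ (λ e → equation-combination (*-congˡ (sym (rise e)))
             (solve 4 (λ s l x y → s :* s :* l :- s :* ((:- x) :- (:- y))
                         := s :* (x :+ s :* l) :- s :* y)
                refl (slope e) (length e) (w (source e)) (w (target e)))) ⟩
      sum (λ e → slope e * (- w (source e) - - w (target e)))
        -- No entry
        ≈⟨ sum-cong-≋ (λ e → *-congˡ (sum-incidence e (λ v → - w v))) ⟨
      sum (λ e → slope e * sum (λ v → - w v * incidence e v))
        ≈⟨ sum-cong-≋ (λ e → *-distribˡ-sum (slope e) (λ v → - w v * incidence e v)) ⟩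
      sum (λ e → sum (λ v → slope e * (- w v * incidence e v)))
        ≈⟨ ∑-comm (λ e v → slope e * (- w v * incidence e v)) ⟩
      sum (λ v → sum (λ e → slope e * (- w v * incidence e v)))
        ≈⟨ sum-cong-≋ (λ v → sum-cong-≋ (λ e →
             solve 3 (λ s x i → s :* (x :* i) := x :* (s :* i)) refl (slope e) (- w v) (incidence e v))) ⟩
      sum (λ v → sum (λ e → - w v * (slope e * incidence e v)))
        ≈⟨ sum-cong-≋ (λ v → *-distribˡ-sum (- w v) (λ e → slope e * incidence e v)) ⟨
      sum (λ v → - w v * sum (λ e → slope e * incidence e v))
        ≈⟨ sum-cong-≋ (λ v → trans (*-congˡ (trans (balance v) (trans (-‿cong (m≈0 v)) -0#≈0#)))
                                   (zeroʳ (- w v))) ⟩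
      sum {#V} (λ _ → 0#)
        ≈⟨ sum-replicate-zero #V ⟩
      0# ∎

    slope≈0 : ∀ e → slope e ≈ 0#
    slope≈0 e = x²*y≈0⇒x≈0 (slope e) (length-pos e)
      (sum≈0⇒≈0 (λ e → slope e * slope e * length e) (λ e → 0≤x²*y (slope e) (length-pos e)) energy≈0 e)

    harmonic⇒constant : ∀ u v → w u ≈ w v
    harmonic⇒constant u v =
      EqClosure.gfold (CommutativeRing.isEquivalence commutativeRing) w along-edge (connected u v)
      where
      along-edge : ∀ {u v} → Adjacent u v → w u ≈ w v
      along-edge (e , ≡.refl , ≡.refl) = sym (begin
        w (target e)                         ≈⟨ rise e ⟩
        w (source e) + slope e * length e    ≈⟨ +-congˡ (trans (*-congʳ (slope≈0 e)) (zeroˡ _)) ⟩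
        w (source e) + 0#                    ≈⟨ +-identityʳ _ ⟩
        w (source e)                         ∎)

module Voltages {c ℓ₁ ℓ₂} (ℝ : RealField c ℓ₁ ℓ₂) (Γ : MetrizedGraph ℝ) where
  open RealFieldProperties ℝ
  open PiecewiseAffineProperties ℝ
  open MetrizedGraph Γ
  open Potentials ℝ Γ
  open ≈-Reasoning setoid

  δ-vertex : ∀ u v → δ Γ (vertex u) (vertex v) ≡ ind u v
  δ-vertex u v with u Fin.≟ v
  ... | yes ≡.refl = ≡.refl
  ... | no  _      = ≡.refl

  δ-refl : ∀ {x y} → _≈ₚ_ Γ x y → δ Γ x y ≈ 1#
  δ-refl {x} {y} x≈y rewrite dec-true (_≟ₚ_ Γ x y) x≈y = refl

  δ-apart : ∀ {x y} → ¬ _≈ₚ_ Γ x y → δ Γ x y ≈ 0#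
  δ-apart {x} {y} x≉y rewrite dec-false (_≟ₚ_ Γ x y) x≉y = refl

  point-interior : ∀ e t (0<t : 0# < t) (t<L : t < length e) → _≈ₚ_ Γ (point Γ e t) (interior e t 0<t t<L)
  point-interior e t 0<t t<L with compare 0# t | compare t (length e)
  ... | tri< _ _ _   | tri< _ _ _   = interior refl
  ... | tri< _ _ _   | tri≈ t≮L _ _ = contradiction t<L t≮L
  ... | tri< _ _ _   | tri> t≮L _ _ = contradiction t<L t≮L
  ... | tri≈ 0≮t _ _ | _            = contradiction 0<t 0≮t
  ... | tri> 0≮t _ _ | _            = contradiction 0<t 0≮t

  point-source : ∀ e → point Γ e 0# ≡ vertex (source e)
  point-source e with compare 0# 0# | compare 0# (length e)
  ... | tri< 0<0 _ _ | _ = contradiction 0<0 (irrefl refl)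
  ... | tri≈ _ _ _   | _ = ≡.refl
  ... | tri> _ _ _   | _ = ≡.refl

  point-target : ∀ e → point Γ e (length e) ≡ vertex (target e)
  point-target e with compare 0# (length e) | compare (length e) (length e)
  ... | tri≈ 0≮L _ _ | _ = contradiction (length-pos e) 0≮L
  ... | tri> 0≮L _ _ | _ = contradiction (length-pos e) 0≮L
  ... | tri< _ _ _   | tri< L<L _ _ = contradiction L<L (irrefl refl)
  ... | tri< _ _ _   | tri≈ _ _ _   = ≡.refl
  ... | tri< _ _ _   | tri> _ _ _   = ≡.refl

  module EdgeSlopes {f : Point Γ → Carrier} (F : IsCPA Γ f) where
    open IsCPA F public

    initialSlope finalSlope : Edge → Carrier
    initialSlope e = derivʳ {ℝ = ℝ} (piecewiseAffine e) 0#
    finalSlope   e = derivˡ {ℝ = ℝ} (piecewiseAffine e) (length e)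

    slopeSum-vertex : ∀ v → slopeSum (vertex v) ≈
      sum (λ e → initialSlope e * ind (source e) v - finalSlope e * ind (target e) v)
    slopeSum-vertex v = sum-cong-≋ λ e → +-cong
      (*-ind (does (source e Fin.≟ v)) (initialSlope e))
      (trans (*-ind (does (target e Fin.≟ v)) (- finalSlope e))
         (solve 2 (λ x y → (:- x) :* y := :- (x :* y)) refl (finalSlope e) (ind (target e) v)))

    smooth-segment : ∀ e {t t′} → 0# ≤ t → t < t′ → t′ ≤ length e →
      (∀ u (0<u : 0# < u) (u<L : u < length e) → t < u → u < t′ → Δ (interior e u 0<u u<L) ≈ 0#) →
      derivˡ {ℝ = ℝ} (piecewiseAffine e) t′ ≈ derivʳ {ℝ = ℝ} (piecewiseAffine e) t ×
      f (point Γ e t′) ≈ f (point Γ e t) + derivʳ {ℝ = ℝ} (piecewiseAffine e) t * (t′ - t)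
    smooth-segment e 0≤t t<t′ t′≤L Δ≈0 =
      smooth⇒affine (piecewiseAffine e) 0≤t t<t′ t′≤L λ u t<u u<t′ →
        equation-combination (Δ≈0 u (≤-<-trans 0≤t t<u) (<-≤-trans u<t′ t′≤L) t<u u<t′)
          (solve 2 (λ l r → l :- r := (:- (r :- l)) :- con 0ℤ) refl
             (derivˡ {ℝ = ℝ} (piecewiseAffine e) u) (derivʳ {ℝ = ℝ} (piecewiseAffine e) u))

    smooth-edge : ∀ e →
      (∀ u (0<u : 0# < u) (u<L : u < length e) → Δ (interior e u 0<u u<L) ≈ 0#) →
      finalSlope e ≈ initialSlope e ×
      f (vertex (target e)) ≈ f (vertex (source e)) + initialSlope e * length e
    smooth-edge e Δ≈0
      with smooth-segment e (inj₂ refl) (length-pos e) (inj₂ refl) (λ u 0<u u<L _ _ → Δ≈0 u 0<u u<L)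
    ... | final≈initial , rise rewrite point-source e | point-target e =
      final≈initial ,
      trans rise (solve 3 (λ x s l → x :+ s :* (l :- con 0ℤ) := x :+ s :* l) refl
                    (f (vertex (source e))) (initialSlope e) (length e))

  voltage-potential : ∀ {z y f} → IsVoltage Γ (vertex z) (vertex y) f →
                      IsPotential (f ∘ vertex) (λ v → ind y v - ind z v)
  voltage-potential {z} {y} {f} U = record
    { slope   = initialSlope
    ; rise    = λ e → proj₂ (smooth-edge e (smooth e))
    ; balance = λ v → begin
        sum (λ e → initialSlope e * incidence e v)
          ≈⟨ sum-cong-≋ (λ e → equation-combination (*-congʳ (proj₁ (smooth-edge e (smooth e))))
               (solve 4 (λ d l s t → d :* (s :- t) :- (d :* s :- l :* t) := l :* t :- d :* t) refl
                  (initialSlope e) (finalSlope e) (ind (source e) v) (ind (target e) v))) ⟩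
        sum (λ e → initialSlope e * ind (source e) v - finalSlope e * ind (target e) v)
          ≈⟨ slopeSum-vertex v ⟨
        slopeSum (vertex v)
          ≈⟨ equation-combination (sym (laplacian (vertex v)))
               (solve 3 (λ σ a b → σ :- (:- (a :- b)) := (a :- b) :- (:- σ)) refl
                  (slopeSum (vertex v)) (δ Γ (vertex y) (vertex v)) (δ Γ (vertex z) (vertex v))) ⟩
        - (δ Γ (vertex y) (vertex v) - δ Γ (vertex z) (vertex v))
          ≡⟨ ≡.cong₂ (λ a b → - (a - b)) (δ-vertex y v) (δ-vertex z v) ⟩
        - (ind y v - ind z v) ∎
    }
    where
    open IsVoltage U
    open EdgeSlopes isCPA
    smooth : ∀ e u (0<u : 0# < u) (u<L : u < length e) → Δ (interior e u 0<u u<L) ≈ 0#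
    smooth e u 0<u u<L = trans (laplacian (interior e u 0<u u<L)) (-‿inverseʳ 0#)

  module InteriorVoltage {i x} {0<x : 0# < x} {x<L : x < length i} {p f}
    (U : IsVoltage Γ (interior i x 0<x x<L) (vertex p) f) (μ : Carrier) (x≈μL : x ≈ μ * length i) where
    open IsVoltage U
    open EdgeSlopes isCPA

    L = length i
    a = source i
    b = target i

    no-pole : ∀ {e u} (0<u : 0# < u) (u<L : u < length e) →
              ¬ _≈ₚ_ Γ (interior i x 0<x x<L) (interior e u 0<u u<L) → Δ (interior e u 0<u u<L) ≈ 0#
    no-pole {e} {u} 0<u u<L apart = trans (laplacian (interior e u 0<u u<L))
      (trans (+-congˡ (-‿cong (δ-apart apart))) (-‿inverseʳ 0#))

    slope-after : Carrier
    slope-after = derivʳ {ℝ = ℝ} (piecewiseAffine i) x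

    f-x≈0 : f (point Γ i x) ≈ 0#
    f-x≈0 = trans (IsCPA.cong isCPA (point-interior i x 0<x x<L)) grounded

    before : derivˡ {ℝ = ℝ} (piecewiseAffine i) x ≈ initialSlope i ×
             f (point Γ i x) ≈ f (point Γ i 0#) + initialSlope i * (x - 0#)
    before = smooth-segment i (inj₂ refl) 0<x (inj₁ x<L)
      (λ u 0<u u<L _ u<x → no-pole 0<u u<L λ { (interior x≈u) → irrefl (sym x≈u) u<x })

    after : finalSlope i ≈ slope-after ×
            f (point Γ i L) ≈ f (point Γ i x) + slope-after * (L - x)
    after = smooth-segment i (inj₁ 0<x) x<L (inj₂ refl)
      (λ u 0<u u<L x<u _ → no-pole 0<u u<L λ { (interior x≈u) → irrefl x≈u x<u })

    source-value : f (vertex a) ≈ - (initialSlope i * (μ * L))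
    source-value = equation-combination
      (+-cong (trans (sym (≡.subst (λ q → f (point Γ i x) ≈ f q + initialSlope i * (x - 0#))
                                    (point-source i) (proj₂ before))) f-x≈0)
              (-‿cong (*-congˡ x≈μL)))
      (solve 4 (λ y s x z → y :- (:- (s :* z))
                  := ((y :+ s :* (x :- con 0ℤ)) :+ (:- (s :* x))) :- (con 0ℤ :+ (:- (s :* z))))
         refl
         (f (vertex a)) (initialSlope i) x (μ * L))

    final≈initial+1 : finalSlope i ≈ initialSlope i + 1#
    final≈initial+1 = equation-combination
      (+-cong (+-cong (proj₁ after) (-‿cong (laplacian (interior i x 0<x x<L))))
              (+-cong (proj₁ before) (δ-refl {interior i x 0<x x<L} (interior refl))))
      (solve 5 (λ d l r f′ k → f′ :- (d :+ con 1ℤ)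
                  := ((f′ :+ (:- (:- (r :- l)))) :+ (l :+ k)) :- ((r :+ (:- (con 0ℤ :- k))) :+ (d :+ con 1ℤ)))
         refl (initialSlope i) (derivˡ {ℝ = ℝ} (piecewiseAffine i) x) slope-after (finalSlope i)
         (δ Γ (interior i x 0<x x<L) (interior i x 0<x x<L)))

    target-value : f (vertex b) ≈ (initialSlope i + 1#) * (L - μ * L)
    target-value = begin
      f (vertex b)                                 ≡⟨ ≡.cong f (point-target i) ⟨
      f (point Γ i L)                              ≈⟨ proj₂ after ⟩
      f (point Γ i x) + slope-after * (L - x)      ≈⟨ +-cong f-x≈0 (*-cong (trans (sym (proj₁ after)) final≈initial+1)
                                                                   (+-congˡ (-‿cong x≈μL))) ⟩
      0# + (initialSlope i + 1#) * (L - μ * L)     ≈⟨ +-identityˡ _ ⟩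
      (initialSlope i + 1#) * (L - μ * L)          ∎

    interpolated-end-values : (1# - μ) * f (vertex a) + μ * f (vertex b) ≈ (1# - μ) * μ * L
    interpolated-end-values = trans (+-cong (*-congˡ source-value) (*-congˡ target-value))
      (solve 3 (λ μ l s → (con 1ℤ :- μ) :* (:- (s :* (μ :* l))) :+ μ :* ((s :+ con 1ℤ) :* (l :- μ :* l))
                  := (con 1ℤ :- μ) :* μ :* l) refl μ L (initialSlope i))

    edge-ends : ∀ e → finalSlope e ≈ initialSlope e + ind i e ×
      f (vertex (target e)) ≈ f (vertex (source e)) + (initialSlope e + (1# - μ) * ind i e) * length e
    edge-ends e with i Fin.≟ e
    ... | yes ≡.refl = final≈initial+1 ,
      equation-combination (+-cong target-value (-‿cong source-value))
        (solve 5 (λ μ l s x y → y :- (x :+ (s :+ (con 1ℤ :- μ) :* con 1ℤ) :* l)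
                    := (y :- x) :- (((s :+ con 1ℤ) :* (l :- μ :* l)) :- (:- (s :* (μ :* l)))))
           refl μ L (initialSlope i) (f (vertex a)) (f (vertex b)))
    ... | no i≢e =
      trans (proj₁ smooth) (sym (+-identityʳ _)) ,
      trans (proj₂ smooth) (solve 4 (λ x s l μ → x :+ s :* l := x :+ (s :+ (con 1ℤ :- μ) :* con 0ℤ) :* l) refl
                              (f (vertex (source e))) (initialSlope e) (length e) μ)
      where
      smooth = smooth-edge e (λ u 0<u u<L → no-pole 0<u u<L λ { (interior _) → i≢e ≡.refl })

    -- The slopes of f at the two ends of i are replaced by their weighted mean
    -- initialSlope i + (1 - μ), which moves the mass at x to the end points with
    -- weights 1 - μ and μ.
    potential : IsPotential (f ∘ vertex) (λ v → ind p v - ((1# - μ) * ind a v + μ * ind b v))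
    potential = record
      { slope   = λ e → initialSlope e + (1# - μ) * ind i e
      ; rise    = λ e → proj₂ (edge-ends e)
      ; balance = λ v → begin
          sum (λ e → (initialSlope e + (1# - μ) * ind i e) * incidence e v)
            ≈⟨ sum-cong-≋ (λ e → equation-combination (*-congʳ (proj₁ (edge-ends e)))
                 (solve 6 (λ d l k μ s t → (d :+ (con 1ℤ :- μ) :* k) :* (s :- t)
                              :- ((d :* s :- l :* t) :+ ((con 1ℤ :- μ) :* s :+ μ :* t) :* k)
                            := l :* t :- (d :+ k) :* t) refl
                    (initialSlope e) (finalSlope e) (ind i e) μ (ind (source e) v) (ind (target e) v))) ⟩
          sum (λ e → initialSlope e * ind (source e) v - finalSlope e * ind (target e) v
                     + ends v e * ind i e)
            ≈⟨ ∑-distrib-+ (λ e → initialSlope e * ind (source e) v - finalSlope e * ind (target e) v)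
                           (λ e → ends v e * ind i e) ⟩
          sum (λ e → initialSlope e * ind (source e) v - finalSlope e * ind (target e) v)
            + sum (λ e → ends v e * ind i e)
            ≈⟨ +-cong (slopeSum-vertex v) (sym (sum-ind i (ends v))) ⟨
          slopeSum (vertex v) + ends v i
            ≈⟨ equation-combination (sym (trans (laplacian (vertex v)) (+-congʳ (reflexive (δ-vertex p v)))))
                 (solve 3 (λ σ k m → (σ :+ k) :- (:- (m :- k)) := (m :- con 0ℤ) :- (:- σ)) refl
                    (slopeSum (vertex v)) (ends v i) (ind p v)) ⟩
          - (ind p v - ends v i) ∎
      }
      where
      ends : Vertex → Edge → Carrier
      ends v e = (1# - μ) * ind (source e) v + μ * ind (target e) v


module ResistanceOnEdge {c ℓ₁ ℓ₂} (ℝ : RealField c ℓ₁ ℓ₂) (Γ : MetrizedGraph ℝ) (J : VoltageFunction Γ) where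
  open RealFieldProperties ℝ
  open MetrizedGraph Γ
  open Potentials ℝ Γ
  open Voltages ℝ Γ
  open VoltageFunction J renaming (resistance to r)
  open ≈-Reasoning setoid

  voltage-sum : ∀ a b p → j (vertex a) (vertex b) (vertex p) + j (vertex b) (vertex a) (vertex p)
                          ≈ r (vertex a) (vertex b)
  voltage-sum a b p = equation-combination
    (+-cong difference-constant
            (+-cong (IsVoltage.grounded (isVoltage (vertex a) (vertex p)))
                    (+-cong (IsVoltage.grounded (isVoltage (vertex b) (vertex p)))
                            (-‿cong (IsVoltage.grounded (isVoltage (vertex b) (vertex a)))))))
    (solve 6 (λ ab ba aa bb ra rb → (ab :+ ba) :- ra
                := (((ba :+ con ℤ.-1ℤ :* aa) :+ con ℤ.-1ℤ :* ra) :+ (aa :+ (bb :+ (:- rb))))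
                   :- (((bb :+ con ℤ.-1ℤ :* ab) :+ con ℤ.-1ℤ :* rb) :+ (con 0ℤ :+ (con 0ℤ :+ (:- con 0ℤ)))))
       refl (u a b) (u b a) (u a a) (u b b) (j (vertex b) (vertex a) (vertex a)) (j (vertex b) (vertex b) (vertex a)))
    where
    u : Vertex → Vertex → Carrier
    u z v = j (vertex z) (vertex v) (vertex p)
    difference-constant = harmonic⇒constant
      (potential-combination
        (potential-combination (voltage-potential (isVoltage (vertex b) (vertex p)))
                               (voltage-potential (isVoltage (vertex a) (vertex p))) (- 1#))
        (voltage-potential (isVoltage (vertex b) (vertex a))) (- 1#))
      (λ v → solve 3 (λ p a b → ((p :- b) :+ con ℤ.-1ℤ :* (p :- a)) :+ con ℤ.-1ℤ :* (a :- b) := con 0ℤ) refl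
               (ind p v) (ind a v) (ind b v))
      a b

  edgeQuadratic : Edge → Vertex → Carrier → Carrier
  edgeQuadratic i p μ =
    - (μ * μ) * (L - r a b) + μ * (L - r a b + r (vertex p) b - r (vertex p) a) + r (vertex p) a
    where
    L = length i
    a = vertex (source i)
    b = vertex (target i)

  edgeQuadratic-cong : ∀ i p {μ ν} → μ ≈ ν → edgeQuadratic i p μ ≈ edgeQuadratic i p ν
  edgeQuadratic-cong i p μ≈ν =
    +-congʳ (+-cong (*-congʳ (-‿cong (*-cong μ≈ν μ≈ν))) (*-congʳ μ≈ν))

  edgeQuadratic-0 : ∀ i p → edgeQuadratic i p 0# ≈ r (vertex p) (vertex (source i))
  edgeQuadratic-0 i p =
    solve 3 (λ u v w → (:- (con 0ℤ :* con 0ℤ)) :* u :+ con 0ℤ :* v :+ w := w) refl _ _ _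

  edgeQuadratic-1 : ∀ i p → edgeQuadratic i p 1# ≈ r (vertex p) (vertex (target i))
  edgeQuadratic-1 i p =
    solve 3 (λ u v w → (:- (con 1ℤ :* con 1ℤ)) :* u :+ con 1ℤ :* (u :+ v :- w) :+ w := v) refl
      (length i - r (vertex (source i)) (vertex (target i)))
      (r (vertex p) (vertex (target i))) (r (vertex p) (vertex (source i)))

  resistance-interior : ∀ i x (0<x : 0# < x) (x<L : x < length i) p μ → x ≈ μ * length i →
                        r (vertex p) (interior i x 0<x x<L) ≈ edgeQuadratic i p μ
  resistance-interior i x 0<x x<L p μ x≈μL = equation-combination
    (+-cong (+-cong (*-congˡ (constant p a)) (*-congˡ (constant p b)))
            (+-cong interpolated-end-values
                    (+-cong (*-congˡ (sym (voltage-sum a b p)))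
                            (+-cong (*-congˡ (grounded′ a)) (*-congˡ (grounded′ b))))))
    (solve 12
       (λ μ l rab xp xa xb ap ab aa bp ba bb →
          let λ′ = con 1ℤ :- μ
              w x y z = (x :+ (:- λ′) :* y) :+ (:- μ) :* z
          in
          xp :- (((:- (μ :* μ)) :* (l :- rab) :+ μ :* (((l :- rab) :+ bp) :- ap)) :+ ap)
            := ((λ′ :* w xp ap bp :+ μ :* w xp ap bp)
                 :+ ((λ′ :* xa :+ μ :* xb)
                 :+ (λ′ :* μ :* rab :+ ((:- (λ′ :* λ′)) :* aa :+ (:- (μ :* μ)) :* bb))))
               :- ((λ′ :* w xa aa ba :+ μ :* w xb ab bb)
                 :+ ((λ′ :* μ :* l)
                 :+ (λ′ :* μ :* (ab :+ ba) :+ ((:- (λ′ :* λ′)) :* con 0ℤ :+ (:- (μ :* μ)) :* con 0ℤ)))))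
       refl
       μ L (r (vertex a) (vertex b))
       (j X (vertex p) (vertex p)) (j X (vertex a) (vertex p)) (j X (vertex b) (vertex p))
       (u a p) (u a b) (u a a) (u b p) (u b a) (u b b))
    where
    X = interior i x 0<x x<L
    open InteriorVoltage (isVoltage X (vertex p)) μ x≈μL
    u : Vertex → Vertex → Carrier
    u z v = j (vertex z) (vertex v) (vertex p)
    grounded′ : ∀ z → u z z ≈ 0#
    grounded′ z = IsVoltage.grounded (isVoltage (vertex z) (vertex p))
    constant = harmonic⇒constant
      (potential-combination
        (potential-combination potential (voltage-potential (isVoltage (vertex a) (vertex p))) (- (1# - μ)))
        (voltage-potential (isVoltage (vertex b) (vertex p))) (- μ))
      (λ v → solve 4 (λ μ p a b → ((p :- ((con 1ℤ :- μ) :* a :+ μ :* b)) :+ (:- (con 1ℤ :- μ)) :* (p :- a))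
                                    :+ (:- μ) :* (p :- b) := con 0ℤ) refl
               μ (ind p v) (ind a v) (ind b v))

  resistance-on-edge : ∀ i x → 0# ≤ x → x ≤ length i → ∀ p →
                       r (vertex p) (point Γ i x) ≈ edgeQuadratic i p (x / length i)
  resistance-on-edge i x 0≤x x≤L p with compare 0# x | compare x (length i)
  ... | tri< 0<x _ _ | tri< x<L _ _ = resistance-interior i x 0<x x<L p (x / L) (begin
    x                  ≈⟨ *-identityʳ x ⟨
    x * 1#             ≈⟨ *-congˡ (⁻¹-inverseʳ L (0<x⇒x≉0 (length-pos i))) ⟨
    x * (L * L ⁻¹)     ≈⟨ solve 3 (λ x l k → x :* (l :* k) := x :* k :* l) refl x L (L ⁻¹) ⟩
    x / L * L          ∎)
    where L = length i
  ... | tri< _ _ _ | tri≈ _ x≈L _ = sym (trans (edgeQuadratic-cong i p x/L≈1) (edgeQuadratic-1 i p))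
    where
    x/L≈1 : x / length i ≈ 1#
    x/L≈1 = trans (*-congʳ x≈L) (⁻¹-inverseʳ (length i) (0<x⇒x≉0 (length-pos i)))
  ... | tri< _ _ _ | tri> x≮L x≉L _ =
    contradiction x≤L λ { (inj₁ x<L) → x≮L x<L ; (inj₂ x≈L) → x≉L x≈L }
  ... | tri≈ _ 0≈x _ | _ = sym (trans (edgeQuadratic-cong i p x/L≈0) (edgeQuadratic-0 i p))
    where
    x/L≈0 : x / length i ≈ 0#
    x/L≈0 = trans (*-congʳ (sym 0≈x)) (zeroˡ _)
  ... | tri> 0≮x 0≉x _ | _ =
    contradiction 0≤x λ { (inj₁ 0<x) → 0≮x 0<x ; (inj₂ 0≈x) → 0≉x 0≈x }

lemma3p2 : ∀ {c ℓ₁ ℓ₂} (ℝ : RealField c ℓ₁ ℓ₂) (Γ : MetrizedGraph ℝ) (J : VoltageFunction Γ) →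
  let open RealField ℝ
      open MetrizedGraph Γ
      r = VoltageFunction.resistance J
  in
  (i : Edge) (x : Carrier) → 0# ≤ x → x ≤ length i → (v : Vertex) →
  let L  = length i
      pᵢ = vertex {Γ = Γ} (source i)
      qᵢ = vertex {Γ = Γ} (target i)
      p  = vertex {Γ = Γ} v
  in
  r p (point Γ i x) ≈
    - (x * x) * ((L - r pᵢ qᵢ) / (L * L))
    + x * ((L - r pᵢ qᵢ + r p qᵢ - r p pᵢ) / L)
    + r p pᵢ
lemma3p2 ℝ Γ J i x 0≤x x≤L v = trans (resistance-on-edge i x 0≤x x≤L v) (+-congʳ (+-cong
  (trans (solve 3 (λ x k u → (:- (x :* k :* (x :* k))) :* u := (:- (x :* x)) :* (u :* (k :* k))) refl
            x (length i ⁻¹) (length i - r (vertex (source i)) (vertex (target i))))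
         (*-congˡ (*-congˡ (sym (square-⁻¹ (length-pos i))))))
  (solve 3 (λ x k u → x :* k :* u := x :* (u :* k)) refl x (length i ⁻¹) _)))
  where
  open RealFieldProperties ℝ
  open MetrizedGraph Γ
  open VoltageFunction J renaming (resistance to r)
  open ResistanceOnEdge ℝ Γ J
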